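{- In the worst case, no algorithm that uses only one disk, accessed by sequential passes, can compute the Burrows–Wheeler transform of a text of length $n$ when the product of the size of its internal memory in bits and its number of passes is $o(n)$; likewise, no such algorithm can invert the Burrows–Wheeler transform (recover $T$ from $\mathrm{bwt}(T)$) when this product is $o(n)$.
   Context: Model: a machine with an internal memory of a given number of bits and a single disk; the input initially resides on the disk, the output must eventually reside on the disk, and the disk is accessed only by sequential passes (scans). For a text $T[1,n]$ over a finite ordered alphabet with a unique smallest terminating character $T[n]$, the suffix array $\mathrm{sa}[1,n]$ lists starting positions of the suffixes of $T$ in lexicographic order, and $\mathrm{bwt}(T)[i] = T[\mathrm{sa}[i]-1]$ if $\mathrm{sa}[i]>1$, $\mathrm{bwt}(T)[i]=T[n]$ if $\mathrm{sa}[i]=1$. "In the worst case" means: for any such algorithm whose (memory size in bits) $\times$ (number of passes) is $o(n)$, there are inputs of length $n$ (for infinitely many $n$) on which it does not produce the correct output. -}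

module Defs where

open import Data.Bool.Base using (Bool)
open import Data.Fin.Base using (Fin; zero; suc; fromℕ; inject₁; toℕ)
import Data.Fin.Properties as Fin
open import Data.List.Base
  using (List; []; _∷_; _++_; _∷ʳ_; map; length; lookup; drop; take; replicate; allFin)
open import Data.List.Relation.Unary.All using (All)
import Data.List.Relation.Binary.Lex.NonStrict as Lex
import Data.List.Sort as Sort
open import Data.Nat.Base using (ℕ; zero; suc; _*_; _≤_)
open import Data.Product.Base using (_×_; _,_; ∃-syntax; proj₂)
open import Data.Sum.Base using (_⊎_; inj₁; inj₂)
open import Data.Vec.Base using (Vec)
open import Level using (0ℓ)
open import Relation.Binary.Bundles using (DecTotalOrder)
import Relation.Binary.Construct.On as On
open import Relation.Binary.PropositionalEquality using (_≡_; _≢_)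

------------------------------------------------------------------------
-- Texts, suffix arrays and the Burrows–Wheeler transform

-- σ ordinary letters together with the terminator, which is the least
-- element of the order on Fin.
Char : ℕ → Set
Char σ = Fin (suc σ)

terminator : ∀ {σ} → Char σ
terminator = zero

IsText : ∀ {σ} → List (Char σ) → Set
IsText T = ∃[ u ] T ≡ u ∷ʳ terminator × All (_≢ terminator) u

module _ {σ : ℕ} (T : List (Char σ)) where

  -- Positions are 0-based.
  suffix : Fin (length T) → List (Char σ)
  suffix i = drop (toℕ i) T

  suffixOrder : DecTotalOrder 0ℓ 0ℓ 0ℓ
  suffixOrder =
    On.decTotalOrder (Lex.≤-decTotalOrder (Fin.≤-decTotalOrder (suc σ))) suffix

  suffixArray : List (Fin (length T))
  suffixArray = Sort.sort suffixOrder (allFin (length T))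

-- The character cyclically preceding a position.
preceding : ∀ {σ} (T : List (Char σ)) → Fin (length T) → Char σ
preceding (c ∷ cs) zero    = lookup (c ∷ cs) (fromℕ (length cs))
preceding (c ∷ cs) (suc i) = lookup (c ∷ cs) (inject₁ i)

bwt : ∀ {σ} → List (Char σ) → List (Char σ)
bwt T = map (preceding T) (suffixArray T)

------------------------------------------------------------------------
-- One-disk machines

data Direction : Set where
  forward backward : Direction

-- In addition to the text characters, disk cells may hold finitely many
-- further symbols, one of which is the blank.
Cell : ℕ → ℕ → Set
Cell σ aux = Char σ ⊎ Fin (suc aux)

blank : ∀ {σ aux} → Cell σ aux
blank = inj₂ zero

-- A machine for inputs of one length.  The pass number and the head
-- address are available to the program without being charged to the
-- memory.  A computation with fewer passes is one whose remaining passes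
-- change nothing, so `passes` is an upper bound on the passes needed.
record Machine (σ : ℕ) : Set where
  field
    memoryBits : ℕ
    passes     : ℕ
    aux        : ℕ   -- number of non-blank auxiliary disk symbols
    spare      : ℕ   -- number of blank cells following the input
    outputAt   : ℕ   -- address at which the output must start

  Memory : Set
  Memory = Vec Bool memoryBits

  field
    start     : Memory
    direction : (pass : ℕ) → Memory → Direction
    step      : (pass address : ℕ) → Memory → Cell σ aux → Memory × Cell σ aux

module _ {M C : Set} (f : ℕ → M → C → M × C) where

  -- One scan of the cells at addresses a, a + 1, …, each being read and
  -- rewritten once.
  scanForward : (a : ℕ) → M → List C → M × List C
  scanForward a m []       = m , []
  scanForward a m (c ∷ cs) =
    let m₁ , c′  = f a m c
        m₂ , cs′ = scanForward (suc a) m₁ cs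
    in  m₂ , c′ ∷ cs′

  scanBackward : (a : ℕ) → M → List C → M × List C
  scanBackward a m []       = m , []
  scanBackward a m (c ∷ cs) =
    let m₁ , cs′ = scanBackward (suc a) m cs
        m₂ , c′  = f a m₁ c
    in  m₂ , c′ ∷ cs′

  scan : Direction → M → List C → M × List C
  scan forward  = scanForward 0
  scan backward = scanBackward 0

module _ {σ : ℕ} (𝓜 : Machine σ) where
  open Machine 𝓜

  runPasses : ℕ → Memory × List (Cell σ aux) → Memory × List (Cell σ aux)
  runPasses zero    s = s
  runPasses (suc t) s =
    let m , disk = runPasses t s in scan (step t) (direction t m) m disk

  finalDisk : List (Char σ) → List (Cell σ aux)
  finalDisk input =
    proj₂ (runPasses passes (start , map inj₁ input ++ replicate spare blank))

  Outputs : (input output : List (Char σ)) → Set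
  Outputs input output =
    take (length output) (drop outputAt (finalDisk input)) ≡ map inj₁ output

-- A machine for each input length, without any uniformity requirement.
Algorithm : ℕ → Set
Algorithm σ = ℕ → Machine σ

cost : ∀ {σ} → Algorithm σ → ℕ → ℕ
cost A n = Machine.memoryBits (A n) * Machine.passes (A n)

-- f n = o(n)
Sublinear : (ℕ → ℕ) → Set
Sublinear f = ∀ k → ∃[ N ] (∀ n → N ≤ n → k * f n ≤ n)

{-# OPTIONS --safe #-}

-- Within one pass, everything the machine writes at addresses ≥ r depends only
-- on the cells there and on two memory states: at the start of the pass and on
-- reaching r.  With m bits of memory and p passes, disks that agree initially
-- beyond r therefore leave at most 2^(2mp) different contents there.
--
-- Let x range over the words of length k on the smallest letter a and the
-- largest letter b.  In x a^k $ the information lies in the first k letters,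
-- but bwt (x a^k $) always starts with a^k, so that, bwt being injective, the
-- information lies beyond its first k letters.  In b^2k x $ it lies beyond the
-- first 2k letters, but bwt (b^2k x $) always ends with b^k $ and carries it in
-- its first 2k letters.  Either way k ≤ 2mp.

module Submission where

open import Defs
open import Data.Bool.Base using (Bool; true; false)
open import Data.Fin.Base as Fin
  using (Fin; zero; suc; toℕ; fromℕ; fromℕ<; inject₁; combine; finToFun; funToFin)
import Data.Fin.Properties as Fin
open import Data.List.Base
  using (List; []; _∷_; _++_; _∷ʳ_; [_]; map; length; lookup; drop; take;
         replicate; reverse; tabulate; allFin; zipWith)
import Data.List.Properties as List
open import Data.List.Membership.Propositional using (_∈_)
open import Data.List.Membership.Propositional.Properties using (∈-allFin; ∈-map⁺; ∈-map⁻)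
open import Data.List.Relation.Binary.Lex using (base; halt; this; next)
import Data.List.Relation.Binary.Lex.NonStrict as Lex
open import Data.List.Relation.Binary.Permutation.Propositional
  using (_↭_; ↭-sym; ↭-trans; ↭-reflexive; ↭⇒↭ₛ; module PermutationReasoning)
open import Data.List.Relation.Binary.Permutation.Propositional.Properties
  using (↭-length; ∈-resp-↭; ++-comm; ++⁺; ↭-reverse; ∷↭∷ʳ; map⁺; All-resp-↭)
import Data.List.Relation.Binary.Permutation.Homogeneous as Homogeneous
open import Data.List.Relation.Binary.Pointwise as Pointwise using (Pointwise; Pointwise-≡⇒≡)
open import Data.List.Relation.Unary.All as All using (All; []; _∷_)
import Data.List.Relation.Unary.All.Properties as All
open import Data.List.Relation.Unary.AllPairs as AllPairs using (AllPairs; []; _∷_)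
import Data.List.Relation.Unary.AllPairs.Properties as AllPairs
open import Data.List.Relation.Unary.Sorted.TotalOrder.Properties
  using (AllPairs⇒Sorted; Sorted⇒AllPairs; ↗↭↗⇒≋)
import Data.List.Sort as Sort
open import Data.Nat.Base
open import Data.Nat.Properties
open import Data.Product.Base using (_×_; _,_; ∃-syntax; proj₁; proj₂)
open import Data.Sum.Base using (inj₁)
open import Data.Sum.Properties using (inj₁-injective) renaming (≡-dec to ⊎-≡-dec)
open import Data.Vec.Base as Vec using (Vec)
open import Function.Base using (_∘_; id; const; flip)
open import Function.Definitions using (Injective)
open import Level using (Level; 0ℓ)
open import Relation.Binary.Bundles using (DecTotalOrder)
open import Relation.Binary.Core using (Rel)
open import Relation.Binary.PropositionalEquality hiding ([_])
open import Relation.Nullary.Decidable.Core using (Dec; yes; no)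
open import Relation.Nullary.Negation.Core using (¬_; contradiction)

private
  variable
    a : Level
    A : Set a
    σ : ℕ

-- Lists

drop-++-≤ : ∀ q (xs : List A) {ys} → q ≤ length xs → drop q (xs ++ ys) ≡ drop q xs ++ ys
drop-++-≤ zero    xs       _         = refl
drop-++-≤ (suc q) (x ∷ xs) (s≤s q≤n) = drop-++-≤ q xs q≤n

drop-length-++ : ∀ q (xs : List A) {ys} → length xs ≡ q → drop q (xs ++ ys) ≡ ys
drop-length-++ _ []       refl = refl
drop-length-++ _ (x ∷ xs) refl = drop-length-++ _ xs refl

take-length-++ : ∀ q (xs : List A) {ys} → length xs ≡ q → take q (xs ++ ys) ≡ xs
take-length-++ _ []       refl = refl
take-length-++ _ (x ∷ xs) refl = cong (x ∷_) (take-length-++ _ xs refl)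

drop-replicate-++ : ∀ {q m} {x : A} {ys} → q ≤ m → drop q (replicate m x ++ ys) ≡ replicate (m ∸ q) x ++ ys
drop-replicate-++ z≤n       = refl
drop-replicate-++ (s≤s q≤m) = drop-replicate-++ q≤m

replicate-+-++ : ∀ q m (x : A) {ys} → replicate (q + m) x ++ ys ≡ replicate q x ++ replicate m x ++ ys
replicate-+-++ zero    m x = refl
replicate-+-++ (suc q) m x = cong (x ∷_) (replicate-+-++ q m x)

tabulate-∷ʳ : ∀ n (f : Fin (suc n) → A) → tabulate f ≡ tabulate (f ∘ inject₁) ∷ʳ f (fromℕ n)
tabulate-∷ʳ zero    f = refl
tabulate-∷ʳ (suc n) f = cong (f zero ∷_) (tabulate-∷ʳ n (f ∘ suc))

tabulate-injective : ∀ {n} {f g : Fin n → A} → tabulate f ≡ tabulate g → f ≗ g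
tabulate-injective eq zero    = List.∷-injectiveˡ eq
tabulate-injective eq (suc i) = tabulate-injective (List.∷-injectiveʳ eq) i

module _ {P : A → Set} where

  All-take-tabulate : ∀ q {n} (f : Fin n → A) → (∀ i → toℕ i < q → P (f i)) → All P (take q (tabulate f))
  All-take-tabulate zero    f p = []
  All-take-tabulate (suc q) {zero}  f p = []
  All-take-tabulate (suc q) {suc n} f p = p zero z<s ∷ All-take-tabulate q (f ∘ suc) (λ i i<q → p (suc i) (s<s i<q))

  All-drop-tabulate : ∀ q {n} (f : Fin n → A) → (∀ i → q ≤ toℕ i → P (f i)) → All P (drop q (tabulate f))
  All-drop-tabulate zero    f p = All.tabulate⁺ (λ i → p i z≤n)
  All-drop-tabulate (suc q) {zero}  f p = []
  All-drop-tabulate (suc q) {suc n} f p = All-drop-tabulate q (f ∘ suc) (λ i q≤i → p (suc i) (s≤s q≤i))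

module _ {R : Rel A 0ℓ} where

  AllPairs-take-tabulate : ∀ q {n} (f : Fin n → A) →
    (∀ {i j} → i Fin.< j → toℕ j < q → R (f i) (f j)) → AllPairs R (take q (tabulate f))
  AllPairs-take-tabulate zero    f p = []
  AllPairs-take-tabulate (suc q) {zero}  f p = []
  AllPairs-take-tabulate (suc q) {suc n} f p =
    All-take-tabulate q (f ∘ suc) (λ j j<q → p z<s (s<s j<q)) ∷
    AllPairs-take-tabulate q (f ∘ suc) (λ i<j j<q → p (s<s i<j) (s<s j<q))

  AllPairs-drop-tabulate : ∀ q {n} (f : Fin n → A) →
    (∀ {i j} → i Fin.< j → q ≤ toℕ i → R (f i) (f j)) → AllPairs R (drop q (tabulate f))
  AllPairs-drop-tabulate zero    f p = AllPairs.tabulate⁺-< (λ i<j → p i<j z≤n)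
  AllPairs-drop-tabulate (suc q) {zero}  f p = []
  AllPairs-drop-tabulate (suc q) {suc n} f p =
    AllPairs-drop-tabulate q (f ∘ suc) (λ i<j q≤i → p (s<s i<j) (s≤s q≤i))

  AllPairs-reverse : ∀ {xs} → AllPairs R xs → AllPairs (flip R) (reverse xs)
  AllPairs-reverse []                       = []
  AllPairs-reverse (_∷_ {x} {xs} x~xs xs~) =
    subst (AllPairs _) (sym (List.unfold-reverse x xs))
      (AllPairs.++⁺ (AllPairs-reverse xs~) ([] ∷ [])
        (All.map (_∷ []) (All-resp-↭ (↭-sym (↭-reverse xs)) x~xs)))

-- Sequential scans

module _ {M C : Set} (f : ℕ → M → C → M × C) where

  -- The cells before `r` influence the later ones only through the memory with which the head
  -- leaves them. The base address `a` is arbitrary because the induction moves it.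
  drop-scanForward : ∀ r a m cs →
    drop r (proj₂ (scanForward f a m cs)) ≡
    proj₂ (scanForward f (r + a) (proj₁ (scanForward f a m (take r cs))) (drop r cs))
  drop-scanForward zero    a m cs       = refl
  drop-scanForward (suc r) a m []       = refl
  drop-scanForward (suc r) a m (c ∷ cs) rewrite sym (+-suc r a) =
    drop-scanForward r (suc a) (proj₁ (f a m c)) cs

  -- A backward scan rewrites the cells beyond `r` before it reads any of the earlier ones.
  drop-scanBackward : ∀ r a m cs →
    drop r (proj₂ (scanBackward f a m cs)) ≡ proj₂ (scanBackward f (r + a) m (drop r cs))
  drop-scanBackward zero    a m cs       = refl
  drop-scanBackward (suc r) a m []       = refl
  drop-scanBackward (suc r) a m (c ∷ cs) rewrite sym (+-suc r a) =
    drop-scanBackward r (suc a) m cs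

  scanTail : Direction → (r : ℕ) (start entry : M) → List C → List C
  scanTail forward  r start entry cs = proj₂ (scanForward f (r + 0) entry cs)
  scanTail backward r start entry cs = proj₂ (scanBackward f (r + 0) start cs)

  drop-scan : ∀ d r m cs →
    drop r (proj₂ (scan f d m cs)) ≡
    scanTail d r m (proj₁ (scanForward f 0 m (take r cs))) (drop r cs)
  drop-scan forward  r m cs = drop-scanForward r 0 m cs
  drop-scan backward r m cs = drop-scanBackward r 0 m cs

bit : Bool → Fin 2
bit false = zero
bit true  = suc zero

bit-injective : Injective _≡_ _≡_ bit
bit-injective {false} {false} _ = refl
bit-injective {true}  {true}  _ = refl

code : ∀ {n} → Vec Bool n → Fin (2 ^ n)
code Vec.[]      = zero
code (b Vec.∷ v) = combine (bit b) (code v)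

code-injective : ∀ {n} → Injective _≡_ _≡_ (code {n})
code-injective {x = Vec.[]}    {Vec.[]}    _  = refl
code-injective {x = b Vec.∷ v} {c Vec.∷ w} eq
  with p , q ← Fin.combine-injective (bit b) (code v) (bit c) (code w) eq
  = cong₂ Vec._∷_ (bit-injective p) (code-injective q)

-- Information carried past an address by the memory

module _ (𝓜 : Machine σ) where
  open Machine 𝓜

  State : Set
  State = Memory × List (Cell σ aux)

  module _ (r : ℕ) where

    -- Computed by a forward scan whatever the direction of the pass, so that all passes have
    -- records of the same shape. Recording two memories per pass is the source of the factor 2 in
    -- the bound.
    entryMemory : ℕ → State → Memory
    entryMemory t s =
      let m , disk = runPasses 𝓜 t s in proj₁ (scanForward (step t) 0 m (take r disk))

    -- The only information reaching the cells at addresses ≥ r in one pass: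
    -- a forward scan brings in the entry memory, a backward scan starts there.
    visit : ℕ → State → Fin (2 ^ memoryBits * 2 ^ memoryBits)
    visit t s = combine (code (proj₁ (runPasses 𝓜 t s))) (code (entryMemory t s))

    -- Packed into a single number, so that the pigeonhole principle for `Fin` applies.
    transcript : State → Fin ((2 ^ memoryBits * 2 ^ memoryBits) ^ passes)
    transcript s = funToFin {passes} (λ t → visit (toℕ t) s)

    module _ {s s′ : State} (start≡ : drop r (proj₂ s) ≡ drop r (proj₂ s′)) where

      -- Induction on the passes. Equal visits give the same starting memory, hence the same
      -- direction, and the same memory at `r`; with equal old tails these determine the new tails.
      -- The cells before `r` may differ throughout.
      tail-determined : ∀ t → (∀ t′ → t′ < t → visit t′ s ≡ visit t′ s′) →
        drop r (proj₂ (runPasses 𝓜 t s)) ≡ drop r (proj₂ (runPasses 𝓜 t s′))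
      tail-determined zero    same = start≡
      tail-determined (suc t) same
        with m≡ , e≡ ← Fin.combine-injective _ (code (entryMemory t s)) _ (code (entryMemory t s′)) (same t ≤-refl)
        = let m , disk = runPasses 𝓜 t s
              m′ , disk′ = runPasses 𝓜 t s′
              tail≡ = tail-determined t (λ t′ t′<t → same t′ (m<n⇒m<1+n t′<t))
          in begin
          drop r (proj₂ (scan (step t) (direction t m) m disk))
            ≡⟨ drop-scan (step t) (direction t m) r m disk ⟩
          scanTail (step t) (direction t m) r m (entryMemory t s) (drop r disk)
            ≡⟨ cong₂ (λ m e → scanTail (step t) (direction t m) r m e (drop r disk))
                 (code-injective m≡) (code-injective e≡) ⟩
          scanTail (step t) (direction t m′) r m′ (entryMemory t s′) (drop r disk)
            ≡⟨ cong (scanTail (step t) (direction t m′) r m′ (entryMemory t s′)) tail≡ ⟩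
          scanTail (step t) (direction t m′) r m′ (entryMemory t s′) (drop r disk′)
            ≡⟨ drop-scan (step t) (direction t m′) r m′ disk′ ⟨
          drop r (proj₂ (scan (step t) (direction t m′) m′ disk′)) ∎
        where open ≡-Reasoning

      transcript-determines-tail : transcript s ≡ transcript s′ →
        drop r (proj₂ (runPasses 𝓜 passes s)) ≡ drop r (proj₂ (runPasses 𝓜 passes s′))
      transcript-determines-tail eq = tail-determined passes λ t t<p →
        subst (λ i → visit i s ≡ visit i s′) (Fin.toℕ-fromℕ< t<p) (begin
          visit (toℕ (fromℕ< t<p)) s                     ≡⟨ Fin.finToFun-funToFin _ (fromℕ< t<p) ⟨
          finToFun (transcript s) (fromℕ< t<p)           ≡⟨ cong (λ c → finToFun c (fromℕ< t<p)) eq ⟩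
          finToFun (transcript s′) (fromℕ< t<p)          ≡⟨ Fin.finToFun-funToFin _ (fromℕ< t<p) ⟩
          visit (toℕ (fromℕ< t<p)) s′                    ∎)
        where open ≡-Reasoning

  -- Decidability allows a failing input to be extracted once it is refuted that all outputs are
  -- correct.
  Outputs? : ∀ input output → Dec (Outputs 𝓜 input output)
  Outputs? input output = List.≡-dec (⊎-≡-dec Fin._≟_ Fin._≟_) _ _

  transcripts<2^ : ∀ {k} → 2 * (memoryBits * passes) < k →
    (2 ^ memoryBits * 2 ^ memoryBits) ^ passes < 2 ^ k
  transcripts<2^ {k} small = begin-strict
    (2 ^ memoryBits * 2 ^ memoryBits) ^ passes ≡⟨ cong (_^ passes) (^-distribˡ-+-* 2 memoryBits memoryBits) ⟨
    (2 ^ (memoryBits + memoryBits)) ^ passes   ≡⟨ ^-*-assoc 2 (memoryBits + memoryBits) passes ⟩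
    2 ^ ((memoryBits + memoryBits) * passes)   ≡⟨ cong (λ b → 2 ^ ((memoryBits + b) * passes)) (+-identityʳ memoryBits) ⟨
    2 ^ (2 * memoryBits * passes)              ≡⟨ cong (2 ^_) (*-assoc 2 memoryBits passes) ⟩
    2 ^ (2 * (memoryBits * passes))            <⟨ ^-monoʳ-< 2 (s≤s (s≤s z≤n)) small ⟩
    2 ^ k                                      ∎
    where open ≤-Reasoning

  -- If beyond position q the inputs agree while the outputs differ, then so
  -- do the disk contents beyond address outputAt + q, wherever the output is
  -- placed: the information must come through the memory.
  bottleneck : ∀ {k q l} (input output : Fin (2 ^ k) → List (Char σ)) {common : List (Char σ)} →
    2 * (memoryBits * passes) < k →
    (∀ x → q ≤ length (input x)) → (∀ x → drop q (input x) ≡ common) →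
    (∀ x → length (output x) ≡ q + l) →
    (∀ {x y} → drop q (output x) ≡ drop q (output y) → x ≡ y) →
    ∃[ x ] ¬ Outputs 𝓜 (input x) (output x)
  bottleneck {k} {q} {l} input output {common} small q≤ agree len inj =
    Fin.¬∀⟶∃¬ _ _ (λ x → Outputs? (input x) (output x)) λ correct →
      -- There are `2 ^ k` inputs but fewer transcripts, so two inputs share one.
      let x , y , x<y , same = Fin.pigeonhole (transcripts<2^ small) (transcript r ∘ initial)
      in Fin.<⇒≢ x<y (inj (List.map-injective inj₁-injective (begin
        map inj₁ (drop q (output x))              ≡⟨ outputTail x (correct x) ⟩
        take l (drop r (finalDisk 𝓜 (input x)))   ≡⟨ cong (take l) (transcript-determines-tail r
                                                       (trans (initialTail x) (sym (initialTail y))) same) ⟩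
        take l (drop r (finalDisk 𝓜 (input y)))   ≡⟨ outputTail y (correct y) ⟨
        map inj₁ (drop q (output y))              ∎)))
    where
    open ≡-Reasoning

    -- On the final disk this is position `q` of the output; on the initial disk it lies at or
    -- beyond position `q`, where the inputs agree, whatever `outputAt` is.
    r = outputAt + q

    blanks : List (Cell σ aux)
    blanks = replicate spare blank

    initial : Fin (2 ^ k) → State
    initial x = start , map inj₁ (input x) ++ blanks

    initialTail : ∀ x → drop r (proj₂ (initial x)) ≡ drop outputAt (map inj₁ common ++ blanks)
    initialTail x = begin
      drop (outputAt + q) (map inj₁ (input x) ++ blanks)      ≡⟨ cong (λ n → drop n (map inj₁ (input x) ++ blanks)) (+-comm outputAt q) ⟩
      drop (q + outputAt) (map inj₁ (input x) ++ blanks)      ≡⟨ List.drop-drop q outputAt _ ⟨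
      drop outputAt (drop q (map inj₁ (input x) ++ blanks))   ≡⟨ cong (drop outputAt) (drop-++-≤ q (map inj₁ (input x))
                                                                  (subst (q ≤_) (sym (List.length-map inj₁ (input x))) (q≤ x))) ⟩
      drop outputAt (drop q (map inj₁ (input x)) ++ blanks)   ≡⟨ cong (λ z → drop outputAt (z ++ blanks))
                                                                  (trans (List.drop-map q (input x)) (cong (map inj₁) (agree x))) ⟩
      drop outputAt (map inj₁ common ++ blanks)               ∎

    -- All outputs have length `q + l`, so their tails occupy one and the same window of `l` cells
    -- starting at `r`.
    outputTail : ∀ x → Outputs 𝓜 (input x) (output x) →
      map inj₁ (drop q (output x)) ≡ take l (drop r (finalDisk 𝓜 (input x)))
    outputTail x correct = begin
      map inj₁ (drop q (output x))                                     ≡⟨ List.drop-map q (output x) ⟨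
      drop q (map inj₁ (output x))                                     ≡⟨ cong (drop q) correct ⟨
      drop q (take (length (output x)) (drop outputAt (finalDisk 𝓜 (input x)))) ≡⟨ cong (λ n → drop q (take n _)) (len x) ⟩
      drop q (take (q + l) (drop outputAt (finalDisk 𝓜 (input x))))    ≡⟨ List.take-drop l q _ ⟨
      take l (drop q (drop outputAt (finalDisk 𝓜 (input x))))          ≡⟨ cong (take l) (List.drop-drop outputAt q _) ⟩
      take l (drop r (finalDisk 𝓜 (input x)))                          ∎

-- The Burrows–Wheeler transform

-- By antisymmetry two sorted arrangements of the same elements agree up to `≈`, which the
-- hypothesis turns into equality.
sort-unique : ∀ (O : DecTotalOrder 0ℓ 0ℓ 0ℓ) →
  (∀ {x y} → DecTotalOrder._≈_ O x y → x ≡ y) →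
  ∀ {xs ys} → AllPairs (DecTotalOrder._≤_ O) xs → xs ↭ ys → Sort.sort O ys ≡ xs
sort-unique O ≈⇒≡ {ys = ys} xs↗ xs↭ys = Pointwise-≡⇒≡ (Pointwise.map ≈⇒≡
  (↗↭↗⇒≋ O.totalOrder (Sort.sort-↗ O ys) (AllPairs⇒Sorted O.totalOrder xs↗)
    (Homogeneous.map O.Eq.reflexive (↭⇒↭ₛ (↭-trans (Sort.sort-↭ O ys) (↭-sym xs↭ys))))))
  where module O = DecTotalOrder O

lexOrder : ℕ → DecTotalOrder 0ℓ 0ℓ 0ℓ
lexOrder σ = Lex.≤-decTotalOrder (Fin.≤-decTotalOrder (suc σ))

_≼_ : Rel (List (Char σ)) 0ℓ
_≼_ {σ} = DecTotalOrder._≤_ (lexOrder σ)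

take-mono-≼ : ∀ m {xs ys : List (Char σ)} → xs ≼ ys → take m xs ≼ take m ys
take-mono-≼ zero    _           = base _
take-mono-≼ (suc m) (base _)    = base _
take-mono-≼ (suc m) halt        = halt
take-mono-≼ (suc m) (this x<y)  = this x<y
take-mono-≼ (suc m) (next x≈y p) = next x≈y (take-mono-≼ m p)

module _ (T : List (Char σ)) where
  private
    n = length T
    rows = suffixArray T
    module S = DecTotalOrder (suffixOrder T)

  suffixArray-↭ : rows ↭ allFin n
  suffixArray-↭ = Sort.sort-↭ (suffixOrder T) (allFin n)

  length-bwt : length (bwt T) ≡ n
  length-bwt = trans (List.length-map (preceding T) rows)
    (trans (↭-length suffixArray-↭) (List.length-tabulate id))

  length-suffix : ∀ i → length (suffix T i) ≡ n ∸ toℕ i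
  length-suffix i = List.length-drop (toℕ i) T

  -- Suffixes at different positions have different lengths.
  suffix-injective : ∀ {i j} → suffix T i ≡ suffix T j → i ≡ j
  suffix-injective {i} {j} eq = Fin.toℕ-injective
    (∸-cancelˡ-≡ (<⇒≤ (Fin.toℕ<n i)) (<⇒≤ (Fin.toℕ<n j))
      (trans (sym (length-suffix i)) (trans (cong length eq) (length-suffix j))))

  suffixArray-unique : ∀ {is} → AllPairs S._≤_ is → is ↭ allFin n → rows ≡ is
  suffixArray-unique = sort-unique (suffixOrder T) (suffix-injective ∘ Pointwise-≡⇒≡)

  sort-↗′ : ∀ is → AllPairs S._≤_ (Sort.sort (suffixOrder T) is)
  sort-↗′ is = Sorted⇒AllPairs S.totalOrder (Sort.sort-↗ (suffixOrder T) is)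

  module _ (q : ℕ) where
    private
      U = take q (allFin n)
      V = drop q (allFin n)
      sort = Sort.sort (suffixOrder T)

      UV : U ++ V ≡ allFin n
      UV = List.take++drop≡id q (allFin n)

      lengthV : length V ≡ n ∸ q
      lengthV = trans (List.length-drop q (allFin n)) (cong (_∸ q) (List.length-tabulate id))

      separated : ∀ {P : Rel (Fin n) 0ℓ} → (∀ {i j} → i Fin.< j → toℕ i < q → q ≤ toℕ j → P i j) →
        All (λ i → All (P i) V) U
      separated p = All-take-tabulate q id λ i i<q →
        All-drop-tabulate q id λ j q≤j → p (<-≤-trans i<q q≤j) i<q q≤j

    -- The suffixes from `q` on precede all others and grow as their positions decrease, so the
    -- suffix array starts with the positions from the last down to `q`.
    take-bwt : (∀ {i j} → i Fin.< j → q ≤ toℕ j → suffix T j ≼ suffix T i) →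
      take (n ∸ q) (bwt T) ≡ reverse (drop q (map (preceding T) (allFin n)))
    take-bwt desc = begin
      take (n ∸ q) (map (preceding T) rows)                     ≡⟨ cong (λ is → take (n ∸ q) (map (preceding T) is)) rows≡ ⟩
      take (n ∸ q) (map (preceding T) (reverse V ++ sort U))    ≡⟨ List.take-map (n ∸ q) (reverse V ++ sort U) ⟩
      map (preceding T) (take (n ∸ q) (reverse V ++ sort U))    ≡⟨ cong (map (preceding T))
                                                                   (take-length-++ (n ∸ q) (reverse V) (trans (List.length-reverse V) lengthV)) ⟩
      map (preceding T) (reverse V)                             ≡⟨ List.reverse-map (preceding T) V ⟩
      reverse (map (preceding T) V)                             ≡⟨ cong reverse (List.drop-map q (allFin n)) ⟨
      reverse (drop q (map (preceding T) (allFin n)))           ∎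
      where
      open ≡-Reasoning
      rows≡ : rows ≡ reverse V ++ sort U
      rows≡ = suffixArray-unique
        (AllPairs.++⁺
          (AllPairs-reverse (AllPairs-drop-tabulate q id λ i<j q≤i → desc i<j (≤-trans q≤i (<⇒≤ i<j))))
          (sort-↗′ U)
          (All-resp-↭ (↭-sym (↭-reverse V))
            (All.map (All-resp-↭ (↭-sym (Sort.sort-↭ (suffixOrder T) U)))
              (All.All-swap (separated λ i<j _ q≤j → desc i<j q≤j)))))
        (↭-trans (++⁺ (↭-reverse V) (Sort.sort-↭ (suffixOrder T) U)) (↭-trans (++-comm V U) (↭-reflexive UV)))

    -- Dually, the suffixes before `q` follow all others, so the suffix array ends with the
    -- positions from `q - 1` down to the first.
    drop-bwt : q ≤ n → (∀ {i j} → i Fin.< j → toℕ i < q → suffix T j ≼ suffix T i) →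
      drop (n ∸ q) (bwt T) ≡ reverse (take q (map (preceding T) (allFin n)))
    drop-bwt q≤n desc = begin
      drop (n ∸ q) (map (preceding T) rows)                     ≡⟨ cong (λ is → drop (n ∸ q) (map (preceding T) is)) rows≡ ⟩
      drop (n ∸ q) (map (preceding T) (sort V ++ reverse U))    ≡⟨ List.drop-map (n ∸ q) (sort V ++ reverse U) ⟩
      map (preceding T) (drop (n ∸ q) (sort V ++ reverse U))    ≡⟨ cong (map (preceding T))
                                                                   (drop-length-++ (n ∸ q) (sort V) (trans (↭-length (Sort.sort-↭ (suffixOrder T) V)) lengthV)) ⟩
      map (preceding T) (reverse U)                             ≡⟨ List.reverse-map (preceding T) U ⟩
      reverse (map (preceding T) U)                             ≡⟨ cong reverse (List.take-map q (allFin n)) ⟨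
      reverse (take q (map (preceding T) (allFin n)))           ∎
      where
      open ≡-Reasoning
      rows≡ : rows ≡ sort V ++ reverse U
      rows≡ = suffixArray-unique
        (AllPairs.++⁺
          (sort-↗′ V)
          (AllPairs-reverse (AllPairs-take-tabulate q id λ i<j j<q → desc i<j (<-trans i<j j<q)))
          (All-resp-↭ (↭-sym (Sort.sort-↭ (suffixOrder T) V))
            (All.map (All-resp-↭ (↭-sym (↭-reverse U)))
              (All.All-swap (separated λ i<j i<q _ → desc i<j i<q)))))
        (↭-trans (++⁺ (Sort.sort-↭ (suffixOrder T) V) (↭-reverse U)) (↭-trans (++-comm V U) (↭-reflexive UV)))

-- Recovering a text from its transform

lookup∷drop : ∀ (xs : List A) i → drop (toℕ i) xs ≡ lookup xs i ∷ drop (suc (toℕ i)) xs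
lookup∷drop (x ∷ xs) zero    = refl
lookup∷drop (x ∷ xs) (suc i) = lookup∷drop xs i

zipWith-map-map : ∀ {A B C D : Set} (h : B → C → D) (f : A → B) (g : A → C) xs →
  zipWith h (map f xs) (map g xs) ≡ map (λ x → h (f x) (g x)) xs
zipWith-map-map h f g []       = refl
zipWith-map-map h f g (x ∷ xs) = cong (h (f x) (g x) ∷_) (zipWith-map-map h f g xs)

module _ {c : Char σ} {cs u : List (Char σ)} (T≡ : c ∷ cs ≡ u ∷ʳ terminator) where
  private
    T = c ∷ cs

    split = List.∷ʳ-injective (tabulate (lookup T ∘ inject₁)) u
      (trans (sym (tabulate-∷ʳ (length cs) (lookup T))) (trans (List.tabulate-lookup T) T≡))

  init-letters : tabulate (lookup T ∘ inject₁) ≡ u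
  init-letters = proj₁ split

  last-letter : lookup T (fromℕ (length cs)) ≡ terminator
  last-letter = proj₂ split

precedings : ∀ {T u : List (Char σ)} → T ≡ u ∷ʳ terminator →
  map (preceding T) (allFin (length T)) ≡ terminator ∷ u
precedings {T = []}     {[]}    ()
precedings {T = []}     {_ ∷ _} ()
precedings {T = c ∷ cs}         T≡ =
  trans (List.map-tabulate id (preceding (c ∷ cs))) (cong₂ _∷_ (last-letter T≡) (init-letters T≡))

-- Prepending the preceding character to a prefix of a suffix gives a longer
-- prefix of the previous suffix; cyclically, the terminator comes from the
-- suffix consisting of the terminator only.
extend : Char σ → List (Char σ) → List (Char σ)
extend zero    xs = [ terminator ]
extend (suc c) xs = suc c ∷ xs

extend-letter : ∀ {c : Char σ} {xs} → c ≢ terminator → extend c xs ≡ c ∷ xs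
extend-letter {c = zero}  c≢ = contradiction refl c≢
extend-letter {c = suc c} c≢ = refl

-- The first `m` columns of the table of sorted suffixes, where short suffixes give short rows.
prefixes : (T : List (Char σ)) → ℕ → List (List (Char σ))
prefixes T m = map (take m ∘ suffix T) (suffixArray T)

-- The classical inversion: each round puts the transform in front as a new column and sorts the
-- rows again.
reconstruct : List (Char σ) → ℕ → List (List (Char σ))
reconstruct     L zero    = map (const []) L
reconstruct {σ} L (suc m) = Sort.sort (lexOrder σ) (zipWith extend L (reconstruct L m))

-- The position `i` on the left is matched with its cyclic successor on the right, whose preceding
-- character is the letter at `i`. The last position thus goes with position 0, which is why the two
-- lists differ by a rotation.
prefixes-extend : ∀ {T : List (Char σ)} → IsText T → ∀ m →
  map (take (suc m) ∘ suffix T) (allFin (length T)) ↭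
  map (λ i → extend (preceding T i) (take m (suffix T i))) (allFin (length T))
prefixes-extend {T = []} ([] , () , _)
prefixes-extend {T = []} (_ ∷ _ , () , _)
prefixes-extend {T = T@(c ∷ cs)} (u , T≡ , letters) m = begin
  map F (allFin n)                             ≡⟨ List.map-tabulate id F ⟩
  tabulate F                                   ≡⟨ tabulate-∷ʳ (length cs) F ⟩
  tabulate (F ∘ inject₁) ∷ʳ F (fromℕ (length cs)) ≡⟨ cong₂ _∷ʳ_ (List.tabulate-cong inner) outer ⟩
  tabulate (G ∘ suc) ∷ʳ G zero                 ↭⟨ ∷↭∷ʳ (G zero) (tabulate (G ∘ suc)) ⟨
  G zero ∷ tabulate (G ∘ suc)                  ≡⟨ List.map-tabulate id G ⟨
  map G (allFin n)                             ∎
  where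
  open PermutationReasoning
  n = length T
  F G : Fin n → List (Char _)
  F i = take (suc m) (suffix T i)
  G i = extend (preceding T i) (take m (suffix T i))

  inner : ∀ i → F (inject₁ i) ≡ G (suc i)
  inner i =
    trans (cong (take (suc m)) (lookup∷drop T (inject₁ i)))
    (trans (cong (λ j → lookup T (inject₁ i) ∷ take m (drop j cs)) (Fin.toℕ-inject₁ i))
    (sym (extend-letter (All.tabulate⁻ (subst (All _) (sym (init-letters T≡)) letters) i))))

  -- Nothing follows the terminator, so for every `m` this prefix is the terminator alone, as in the
  -- special case of `extend`.
  outer : F (fromℕ (length cs)) ≡ G zero
  outer =
    trans (cong (take (suc m)) (lookup∷drop T (fromℕ (length cs))))
    (trans (cong₂ (λ d xs → d ∷ take m xs) (last-letter T≡)
      (List.drop-all _ cs (≤-reflexive (sym (Fin.toℕ-fromℕ (length cs))))))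
    (trans (cong (terminator ∷_) (List.take-[] m))
    (cong (λ d → extend d (take m T)) (sym (last-letter T≡)))))

-- Truncating sorted suffixes keeps them sorted, and by `prefixes-extend` the longer prefixes are a
-- permutation of the extended rows; hence sorting those rows yields exactly the longer prefixes.
prefixes-reconstruct : ∀ {T : List (Char σ)} → IsText T → ∀ m → prefixes T m ≡ reconstruct (bwt T) m
prefixes-reconstruct {T = T} text zero    = List.map-∘ (suffixArray T)
prefixes-reconstruct {σ} {T} text (suc m) = sym (begin
  sort (zipWith extend (bwt T) (reconstruct (bwt T) m)) ≡⟨ cong (sort ∘ zipWith extend (bwt T)) (prefixes-reconstruct text m) ⟨
  sort (zipWith extend (bwt T) (prefixes T m))          ≡⟨ cong sort (zipWith-map-map extend (preceding T) (take m ∘ suffix T) rows) ⟩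
  sort (map G rows)                                     ≡⟨ sort-unique (lexOrder σ) Pointwise-≡⇒≡ sorted permuted ⟩
  map F rows                                            ∎)
  where
  open ≡-Reasoning
  sort = Sort.sort (lexOrder σ)
  rows = suffixArray T
  F G : Fin (length T) → List (Char σ)
  F i = take (suc m) (suffix T i)
  G i = extend (preceding T i) (take m (suffix T i))

  permuted : map F rows ↭ map G rows
  permuted = ↭-trans (map⁺ F (suffixArray-↭ T))
    (↭-trans (prefixes-extend text m) (↭-sym (map⁺ G (suffixArray-↭ T))))

  sorted : AllPairs _≼_ (map F rows)
  sorted = AllPairs.map⁺ (AllPairs.map (take-mono-≼ (suc m)) (sort-↗′ T (allFin (length T))))

-- Any suffix other than the whole of `T′` is too short to contain `T`.
prefix-of-suffix : ∀ (T T′ : List A) → length T ≡ length T′ →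
  ∀ {j} → j < length T′ → T ≡ take (length T) (drop j T′) → T ≡ T′
prefix-of-suffix T T′ len {zero}  _ eq = trans eq (List.take-all _ T′ (≤-reflexive (sym len)))
prefix-of-suffix T T′ len {suc j} j<n eq = contradiction (begin-strict
  length T                                  ≡⟨ cong length eq ⟩
  length (take (length T) (drop (suc j) T′)) ≡⟨ List.length-take (length T) (drop (suc j) T′) ⟩
  length T ⊓ length (drop (suc j) T′)       ≤⟨ m⊓n≤n _ _ ⟩
  length (drop (suc j) T′)                  ≡⟨ List.length-drop (suc j) T′ ⟩
  length T′ ∸ suc j                         <⟨ ∸-monoʳ-< z<s (<⇒≤ j<n) ⟩
  length T′                                 ≡⟨ len ⟨
  length T                                  ∎) (<-irrefl refl)
  where open ≤-Reasoning

-- At `m = length T` the text `T` is itself a row of its table. The same row occurs in the table of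
-- `T′`, as both are reconstructed from one transform.
bwt-injective : ∀ {T T′ : List (Char σ)} → IsText T → IsText T′ → bwt T ≡ bwt T′ → T ≡ T′
bwt-injective {T = []} ([] , () , _)
bwt-injective {T = []} (_ ∷ _ , () , _)
bwt-injective {T = T@(_ ∷ _)} {T′} text text′ eq
  = let j , _ , T≡ = ∈-map⁻ (take (length T) ∘ suffix T′) T∈
    in prefix-of-suffix T T′ (trans (sym (length-bwt T)) (trans (cong length eq) (length-bwt T′)))
         (Fin.toℕ<n j) T≡
  where
  T∈ : T ∈ prefixes T′ (length T)
  T∈ = subst₂ _∈_ (List.take-all (length T) T ≤-refl)
    (trans (prefixes-reconstruct text (length T))
      (trans (cong (λ L → reconstruct L (length T)) eq) (sym (prefixes-reconstruct text′ (length T)))))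
    (∈-map⁺ (take (length T) ∘ suffix T) (∈-resp-↭ (↭-sym (suffixArray-↭ T)) (∈-allFin zero)))

-- Comparisons with runs of extreme letters

terminator-least : ∀ {c : Char σ} {cs ds} → c ≢ terminator → (terminator ∷ cs) ≼ (c ∷ ds)
terminator-least c≢ = this (z≤n , c≢ ∘ sym)

smallest : Char (suc σ)
smallest = suc zero

smallest-least : ∀ {c : Char (suc σ)} → c ≢ terminator → smallest {σ} Fin.≤ c
smallest-least {c = zero}  c≢ = contradiction refl c≢
smallest-least {c = suc c} c≢ = s≤s z≤n

-- As long as `v` lasts, no letter of `w` is below its counterpart; then the terminator after `v`
-- meets a letter or the other terminator.
smallest-run-≼ : ∀ {v w : List (Char (suc σ))} → All (_≡ smallest) v → All (_≢ terminator) w →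
  length v ≤ length w → (v ∷ʳ terminator) ≼ (w ∷ʳ terminator)
smallest-run-≼ {w = []}    []          _          _          = next refl (base _)
smallest-run-≼ {w = _ ∷ _} []          (d≢ ∷ _)   _          = terminator-least d≢
smallest-run-≼ {w = d ∷ w} (refl ∷ v≡) (d≢ ∷ w≢) (s≤s v≤w) with smallest Fin.≟ d
... | yes a≡d = next a≡d (smallest-run-≼ v≡ w≢ v≤w)
... | no  a≢d = this (smallest-least d≢ , a≢d)

largest : Char (suc σ)
largest {σ} = fromℕ (suc σ)

-- While facing the run, `w` either drops strictly below it or copies it; in the latter case `w`
-- ends no later than the run, and its terminator decides.
below-largest-run : ∀ m (w z : List (Char (suc σ))) → All (_≢ terminator) z → length w ≤ m →
  (w ∷ʳ terminator) ≼ ((replicate m largest ++ z) ∷ʳ terminator)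
below-largest-run zero    []      []      _        _ = next refl (base _)
below-largest-run zero    []      (d ∷ z) (d≢ ∷ _) _ = terminator-least d≢
below-largest-run (suc m) []      z       _        _ = terminator-least λ ()
below-largest-run (suc m) (c ∷ w) z       z≢ (s≤s w≤m) with c Fin.≟ largest
... | yes c≡b = next c≡b (below-largest-run m w z z≢ w≤m)
... | no  c≢b = this (Fin.≤fromℕ c , c≢b)

-- If `w` starts with the largest letter, removing that letter from both sides leaves a comparison
-- of the same form, since copies of one letter commute; any other first letter is strictly smaller.
prepend-largest : ∀ r (w : List (Char (suc σ))) →
  (w ∷ʳ terminator) ≼ ((replicate r largest ++ w) ∷ʳ terminator)
prepend-largest {σ} zero w      = DecTotalOrder.refl (lexOrder (suc σ)) {w ∷ʳ terminator}
prepend-largest (suc r) []      = terminator-least λ ()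
prepend-largest (suc r) (c ∷ w) with c Fin.≟ largest
... | no  c≢b  = this (Fin.≤fromℕ c , c≢b)
... | yes refl = next refl (subst (λ z → (w ∷ʳ terminator) ≼ (z ∷ʳ terminator))
                   (shift r w) (prepend-largest (suc r) w))
  where
  shift : ∀ r w → replicate (suc r) largest ++ w ≡ replicate r largest ++ largest ∷ w
  shift zero    w = refl
  shift (suc r) w = cong (largest ∷_) (shift r w)

position≤ : ∀ (u : List A) {c} (i : Fin (length (u ∷ʳ c))) → toℕ i ≤ length u
position≤ u {c} i = s≤s⁻¹ (subst (toℕ i <_) (List.length-++-comm u [ c ]) (Fin.toℕ<n i))

suffix-∷ʳ : ∀ (u : List (Char σ)) i →
  suffix (u ∷ʳ terminator) i ≡ drop (toℕ i) u ∷ʳ terminator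
suffix-∷ʳ u i = drop-++-≤ (toℕ i) u (position≤ u i)

module Word {ℓ : Fin 2 → A} (ℓ-injective : Injective _≡_ _≡_ ℓ) (k : ℕ) where

  -- The binary digits of `x` select the letters, so the words are indexed by a `Fin` as the
  -- pigeonhole argument requires.
  word : Fin (2 ^ k) → List A
  word x = tabulate {n = k} (ℓ ∘ finToFun x)

  length-word : ∀ x → length (word x) ≡ k
  length-word x = List.length-tabulate (ℓ ∘ finToFun x)

  word-injective : Injective _≡_ _≡_ word
  word-injective {x} {y} eq = begin
    x                            ≡⟨ Fin.funToFin-finToFin {k} x ⟨
    funToFin (finToFun {2} {k} x) ≡⟨ funToFin-cong (λ i → ℓ-injective (tabulate-injective eq i)) ⟩
    funToFin (finToFun {2} {k} y) ≡⟨ Fin.funToFin-finToFin {k} y ⟩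
    y                            ∎
    where
    open ≡-Reasoning
    funToFin-cong : ∀ {m n} {f g : Fin m → Fin n} → f ≗ g → funToFin f ≡ funToFin g
    funToFin-cong {zero}  f≗g = refl
    funToFin-cong {suc m} f≗g = cong₂ combine (f≗g zero) (funToFin-cong (f≗g ∘ suc))

-- A cut inside the run only shortens it, which `prepend-largest` handles. A cut beyond it leaves at
-- most `length x` letters, not more than the run has.
drop-largest-run-≼ : ∀ r p {x : List (Char (suc σ))} → All (_≢ terminator) x → length x ≤ p →
  (drop r (replicate p largest ++ x) ∷ʳ terminator) ≼ ((replicate p largest ++ x) ∷ʳ terminator)
drop-largest-run-≼ r p {x} x≢ x≤p with r ≤? p
... | yes r≤p = subst₂ (λ v w → (v ∷ʳ terminator) ≼ (w ∷ʳ terminator))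
  (sym (drop-replicate-++ r≤p))
  (trans (sym (replicate-+-++ r (p ∸ r) largest)) (cong (λ m → replicate m largest ++ x) (m+[n∸m]≡n r≤p)))
  (prepend-largest r (replicate (p ∸ r) largest ++ x))
... | no  r≰p = below-largest-run p _ x x≢ (begin
  length (drop r (replicate p largest ++ x)) ≡⟨ List.length-drop r (replicate p largest ++ x) ⟩
  length (replicate p largest ++ x) ∸ r      ≡⟨ cong (_∸ r) (List.length-++ (replicate p largest)) ⟩
  length (replicate p largest) + length x ∸ r ≡⟨ cong (λ m → m + length x ∸ r) (List.length-replicate p) ⟩
  p + length x ∸ r                           ≤⟨ ∸-monoʳ-≤ (p + length x) (≰⇒≥ r≰p) ⟩
  p + length x ∸ p                           ≡⟨ m+n∸m≡n p (length x) ⟩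
  length x                                   ≤⟨ x≤p ⟩
  p                                          ∎)
  where open ≤-Reasoning

-- The two families of hard texts

module SmallTail (k : ℕ) {x : List (Char (suc σ))} (x≢ : All (_≢ terminator) x) (length-x : length x ≡ k) where
  private
    u : List (Char (suc σ))
    u = x ++ replicate k smallest

    u≢ : All (_≢ terminator) u
    u≢ = All.++⁺ x≢ (All.replicate⁺ k λ ())

    length-u : length u ≡ k + k
    length-u = trans (List.length-++ x) (cong₂ _+_ length-x (List.length-replicate k))

    drop-u : drop k u ≡ replicate k smallest
    drop-u = drop-length-++ k x length-x

  text : List (Char (suc σ))
  text = u ∷ʳ terminator

  isText : IsText text
  isText = u , refl , u≢

  length-text : length text ≡ k + suc k
  length-text = trans (List.length-++-comm u [ terminator ]) (trans (cong suc length-u) (sym (+-suc k k)))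

  drop-text : drop k text ≡ replicate k smallest ∷ʳ terminator
  drop-text = trans (drop-++-≤ k u (subst (k ≤_) (sym length-u) (m≤m+n k k))) (cong (_∷ʳ terminator) drop-u)

  -- The suffixes starting in the final run of the smallest letter come first.
  take-bwt-text : take k (bwt text) ≡ reverse (replicate k smallest)
  take-bwt-text = begin
    -- The cut is at `suc k`, one past the start of the run, so that the preceding letters all
    -- belong to the run; position `k` would contribute the last letter of `x`.
    take k (bwt text)                         ≡⟨ cong (λ m → take m (bwt text)) (trans (cong (_∸ suc k) length-text) (m+n∸n≡m k (suc k))) ⟨
    take (length text ∸ suc k) (bwt text)     ≡⟨ take-bwt text (suc k) descending ⟩
    reverse (drop (suc k) (map (preceding text) (allFin (length text)))) ≡⟨ cong (reverse ∘ drop (suc k)) (precedings refl) ⟩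
    reverse (drop k u)                        ≡⟨ cong reverse drop-u ⟩
    reverse (replicate k smallest)            ∎
    where
    open ≡-Reasoning
    descending : ∀ {i j} → i Fin.< j → suc k ≤ toℕ j → suffix text j ≼ suffix text i
    descending {i} {j} i<j k<j = subst₂ _≼_ (sym (suffix-∷ʳ u j)) (sym (suffix-∷ʳ u i))
      (smallest-run-≼
        (subst (All (_≡ smallest))
          (trans (List.drop-drop k (toℕ j ∸ k) u) (cong (λ m → drop m u) (m+[n∸m]≡n (<⇒≤ k<j))))
          (All.drop⁺ (toℕ j ∸ k) (subst (All _) (sym drop-u) (All.replicate⁺ k refl))))
        (All.drop⁺ (toℕ i) u≢)
        (subst₂ _≤_ (sym (List.length-drop (toℕ j) u)) (sym (List.length-drop (toℕ i) u))
          (∸-monoʳ-≤ (length u) (<⇒≤ i<j))))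

module LargeHead (k : ℕ) {x : List (Char (suc σ))} (x≢ : All (_≢ terminator) x) (length-x : length x ≡ k) where
  private
    u : List (Char (suc σ))
    u = replicate (k + k) largest ++ x

    length-u : length u ≡ k + k + k
    length-u = trans (List.length-++ (replicate (k + k) largest)) (cong₂ _+_ (List.length-replicate (k + k)) length-x)

  text : List (Char (suc σ))
  text = u ∷ʳ terminator

  isText : IsText text
  isText = u , refl , All.++⁺ (All.replicate⁺ (k + k) λ ()) x≢

  length-text : length text ≡ k + k + suc k
  length-text = trans (List.length-++-comm u [ terminator ]) (trans (cong suc length-u) (sym (+-suc (k + k) k)))

  drop-text : drop (k + k) text ≡ x ∷ʳ terminator
  drop-text = trans (drop-++-≤ (k + k) u (subst (k + k ≤_) (sym length-u) (m≤m+n (k + k) k)))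
    (cong (_∷ʳ terminator) (drop-length-++ (k + k) _ (List.length-replicate (k + k))))

  -- The suffixes with at least k leading copies of the largest letter come last.
  drop-bwt-text : drop (k + k) (bwt text) ≡ reverse (terminator ∷ replicate k largest)
  drop-bwt-text = begin
    drop (k + k) (bwt text)                   ≡⟨ cong (λ m → drop m (bwt text)) (trans (cong (_∸ suc k) length-text) (m+n∸n≡m (k + k) (suc k))) ⟨
    drop (length text ∸ suc k) (bwt text)     ≡⟨ drop-bwt text (suc k) (subst (suc k ≤_) (sym length-text) (m≤n+m (suc k) (k + k))) descending ⟩
    reverse (take (suc k) (map (preceding text) (allFin (length text)))) ≡⟨ cong (reverse ∘ take (suc k)) (precedings refl) ⟩
    reverse (terminator ∷ take k u)           ≡⟨ cong (λ z → reverse (terminator ∷ take k z)) (replicate-+-++ k k largest) ⟩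
    reverse (terminator ∷ take k (replicate k largest ++ replicate k largest ++ x))
                                              ≡⟨ cong (λ z → reverse (terminator ∷ z)) (take-length-++ k (replicate k largest) (List.length-replicate k)) ⟩
    reverse (terminator ∷ replicate k largest) ∎
    where
    open ≡-Reasoning
    descending : ∀ {i j} → i Fin.< j → toℕ i < suc k → suffix text j ≼ suffix text i
    -- Since `i ≤ k`, at least `k` copies of the largest letter remain in front of `x`; this is why
    -- the run has length `k + k`.
    descending {i} {j} i<j (s≤s i≤k) = subst₂ _≼_ (sym suffix-j) (sym suffix-i)
      (drop-largest-run-≼ (toℕ j ∸ toℕ i) (k + k ∸ toℕ i) x≢
        (subst (_≤ k + k ∸ toℕ i) (trans (m+n∸n≡m k k) (sym length-x)) (∸-monoʳ-≤ (k + k) i≤k)))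
      where
      drop-i : drop (toℕ i) u ≡ replicate (k + k ∸ toℕ i) largest ++ x
      drop-i = drop-replicate-++ (≤-trans i≤k (m≤m+n k k))

      suffix-i : suffix text i ≡ (replicate (k + k ∸ toℕ i) largest ++ x) ∷ʳ terminator
      suffix-i = trans (suffix-∷ʳ u i) (cong (_∷ʳ terminator) drop-i)

      suffix-j : suffix text j ≡ drop (toℕ j ∸ toℕ i) (replicate (k + k ∸ toℕ i) largest ++ x) ∷ʳ terminator
      suffix-j = begin
        suffix text j                                    ≡⟨ suffix-∷ʳ u j ⟩
        drop (toℕ j) u ∷ʳ terminator                     ≡⟨ cong (λ m → drop m u ∷ʳ terminator) (m+[n∸m]≡n (<⇒≤ i<j)) ⟨
        drop (toℕ i + (toℕ j ∸ toℕ i)) u ∷ʳ terminator   ≡⟨ cong (_∷ʳ terminator) (List.drop-drop (toℕ i) (toℕ j ∸ toℕ i) u) ⟨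
        drop (toℕ j ∸ toℕ i) (drop (toℕ i) u) ∷ʳ terminator ≡⟨ cong (λ z → drop (toℕ j ∸ toℕ i) z ∷ʳ terminator) drop-i ⟩
        drop (toℕ j ∸ toℕ i) (replicate (k + k ∸ toℕ i) largest ++ x) ∷ʳ terminator ∎

-- The lower bound

-- The factor 8 comes from `8 * c ≤ 3 * k + 1 < 4 * k`, which needs `2 ≤ k`.
twice-small : ∀ {c n k} → 2 ≤ k → 8 * c ≤ n → n ≤ k + k + suc k → 2 * c < k
twice-small {c} {n} {k} 2≤k 8c≤n n≤ = *-cancelˡ-< 4 (2 * c) k (begin-strict
  4 * (2 * c)      ≡⟨ *-assoc 4 2 c ⟨
  8 * c            ≤⟨ 8c≤n ⟩
  n                ≤⟨ n≤ ⟩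
  k + k + suc k    <⟨ +-monoʳ-< (k + k) (≤-reflexive refl) ⟩
  k + k + (2 + k)  ≤⟨ +-monoʳ-≤ (k + k) (+-monoˡ-≤ k 2≤k) ⟩
  k + k + (k + k)  ≡⟨ +-assoc k k (k + k) ⟩
  k + (k + (k + k)) ≡⟨ cong (λ z → k + (k + (k + z))) (+-identityʳ k) ⟨
  4 * k            ∎)
  where open ≤-Reasoning

theorem7 : (σ : ℕ) → 2 ≤ σ → (A : Algorithm σ) → Sublinear (cost A) →
    (∀ (N : ℕ) → ∃[ n ] N ≤ n ×
    (∃[ T ] IsText T × length T ≡ n × ¬ Outputs (A n) T (bwt T)))
    ×
    (∀ (N : ℕ) → ∃[ n ] N ≤ n ×
    (∃[ T ] IsText T × length T ≡ n × ¬ Outputs (A n) (bwt T) T))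
theorem7 (suc zero) (s≤s ())
theorem7 (suc (suc σ)) _ A sublinear = transform , invert
  where
  letter : Fin 2 → Char (2 + σ)
  letter zero    = smallest
  letter (suc _) = largest

  letter-injective : Injective _≡_ _≡_ letter
  letter-injective {zero}     {zero}     _ = refl
  letter-injective {suc zero} {suc zero} _ = refl

  letter≢ : ∀ i → letter i ≢ terminator
  letter≢ zero    ()
  letter≢ (suc _) ()

  module _ (N : ℕ) where
    threshold = proj₁ (sublinear 8)
    -- The summands provide `2 ≤ k` for `twice-small`, lengths of at least `N`, and lengths at which
    -- `sublinear 8` applies.
    k = 2 + (N + threshold)

    open Word letter-injective k

    word≢ : ∀ x → All (_≢ terminator) (word x)
    word≢ x = All.tabulate⁺ (letter≢ ∘ finToFun x)

    module S x = SmallTail k (word≢ x) (length-word x)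
    module L x = LargeHead k (word≢ x) (length-word x)

    N≤k : N ≤ k
    N≤k = ≤-trans (m≤m+n N threshold) (m≤n+m _ 2)

    small : ∀ n → k ≤ n → n ≤ k + k + suc k → 2 * cost A n < k
    small n k≤n = twice-small {cost A n} (s≤s (s≤s z≤n))
      (proj₂ (sublinear 8) n (≤-trans (≤-trans (m≤n+m threshold N) (m≤n+m _ 2)) k≤n))

    k≤k+1+k : k ≤ k + suc k
    k≤k+1+k = m≤m+n k (suc k)

    transform : ∃[ n ] N ≤ n × (∃[ T ] IsText T × length T ≡ n × ¬ Outputs (A n) T (bwt T))
    transform =
      let n = k + suc k
          x , wrong = bottleneck (A n) {q = k} {l = suc k} S.text (bwt ∘ S.text)
            (small n k≤k+1+k (+-monoˡ-≤ (suc k) (m≤m+n k k)))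
            (λ x → subst (k ≤_) (sym (S.length-text x)) k≤k+1+k)
            S.drop-text
            (λ x → trans (length-bwt (S.text x)) (S.length-text x))
            (λ {x} {y} → injective {x} {y})
      in n , ≤-trans N≤k k≤k+1+k , S.text x , S.isText x , S.length-text x , wrong
      where
      open ≡-Reasoning
      -- The first `k` letters of the transform are the same for all words, so equal tails give
      -- equal transforms and, by `bwt-injective`, equal texts.
      injective : ∀ {x y} → drop k (bwt (S.text x)) ≡ drop k (bwt (S.text y)) → x ≡ y
      injective {x} {y} eq = word-injective (begin
        word x                                   ≡⟨ take-length-++ k (word x) (length-word x) ⟨
        take k (word x ++ replicate k smallest)  ≡⟨ cong (take k) (List.∷ʳ-injectiveˡ _ _ texts≡) ⟩
        take k (word y ++ replicate k smallest)  ≡⟨ take-length-++ k (word y) (length-word y) ⟩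
        word y                                   ∎)
        where
        texts≡ : S.text x ≡ S.text y
        texts≡ = bwt-injective (S.isText x) (S.isText y) (begin
          bwt (S.text x)                                      ≡⟨ List.take++drop≡id k _ ⟨
          take k (bwt (S.text x)) ++ drop k (bwt (S.text x))  ≡⟨ cong₂ _++_ (trans (S.take-bwt-text x) (sym (S.take-bwt-text y))) eq ⟩
          take k (bwt (S.text y)) ++ drop k (bwt (S.text y))  ≡⟨ List.take++drop≡id k _ ⟩
          bwt (S.text y)                                      ∎)

    invert : ∃[ n ] N ≤ n × (∃[ T ] IsText T × length T ≡ n × ¬ Outputs (A n) (bwt T) T)
    invert =
      let n = k + k + suc k
          x , wrong = bottleneck (A n) {q = k + k} {l = suc k} (bwt ∘ L.text) L.text
            (small n k≤n ≤-refl)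
            (λ x → subst (k + k ≤_) (sym (trans (length-bwt (L.text x)) (L.length-text x))) (m≤m+n (k + k) (suc k)))
            L.drop-bwt-text
            L.length-text
            -- Beyond position `k + k` the text is the word followed by the terminator, so the word
            -- is read off directly.
            (λ {x} {y} eq → word-injective
              (List.∷ʳ-injectiveˡ _ _ (trans (sym (L.drop-text x)) (trans eq (L.drop-text y)))))
      in n , ≤-trans N≤k k≤n , L.text x , L.isText x , L.length-text x , wrong
      where
      k≤n : k ≤ k + k + suc k
      k≤n = ≤-trans (m≤m+n k k) (m≤m+n (k + k) (suc k))
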